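{- Let $K$ be a number field, let $d\ge 2$, and let $f(z)\in K[z]$ be a unicritical polynomial of degree $d$. Then either $f(z)$ is $\overline{K}$-conjugate to $z^d$, or $f$ is $\overline{K}$-conjugate to a unique polynomial of the form $az^d+1\in K[z]$ (with $a\neq 0$).
   Context: A polynomial $f$ is unicritical if it has exactly one critical point in $\overline{K}$, i.e. exactly one $\gamma\in\overline K$ with $f'(\gamma)=0$. Polynomials $f,g$ are $\overline{K}$-conjugate if $g=\phi\circ f\circ\phi^{ -1}$ for some affine map $\phi(z)=\alpha z+\beta$ with $\alpha,\beta\in\overline{K}$, $\alpha\neq 0$. -}

module Defs where

open import Algebra.Apartness.Bundles using (HeytingField)
open import Algebra.Apartness.Structures using (IsHeytingField)
open import Algebra.Bundles using (CommutativeRing)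
open import Algebra.Bundles.Raw using (RawRing)
open import Algebra.Core using (Op₁; Op₂)
open import Algebra.Morphism.Structures using (IsRingHomomorphism)
import Algebra.Definitions.RawSemiring as RawSemiringDefinitions
open import Data.Fin.Base using (Fin)
open import Data.List.Base using (List; []; _∷_; [_]; _++_; foldr; map; replicate)
open import Data.Nat.Base using (ℕ; zero; suc; _<_)
open import Data.Product using (Σ-syntax; ∃-syntax; ∃!; _×_; proj₁)
open import Data.Rational.Base using (ℚ; +-*-rawRing)
open import Level using (_⊔_) renaming (suc to lsuc)
open import Relation.Binary.Core using (Rel)
open import Relation.Binary.Definitions using (Decidable)
open import Relation.Nullary.Negation using (¬_)

-- Discrete fields: the Heyting fields whose apartness is the negation of a
-- decidable equality.  Classically these are exactly the fields.  Note that
-- 1# ≉ 0# follows from `invertible⇒#`.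
record Field c ℓ : Set (lsuc (c ⊔ ℓ)) where
  infix  8 -_
  infixl 7 _*_
  infixl 6 _+_
  infix  4 _≈_ _≉_ _≟_
  field
    Carrier : Set c
    _≈_     : Rel Carrier ℓ

  _≉_ : Rel Carrier ℓ
  x ≉ y = ¬ (x ≈ y)

  field
    _+_            : Op₂ Carrier
    _*_            : Op₂ Carrier
    -_             : Op₁ Carrier
    0#             : Carrier
    1#             : Carrier
    isHeytingField : IsHeytingField _≈_ _≉_ _+_ _*_ -_ 0# 1#
    _≟_            : Decidable _≈_

  open IsHeytingField isHeytingField public
    using (isCommutativeRing; #⇒invertible)

  heytingField : HeytingField c ℓ ℓ
  heytingField = record { isHeytingField = isHeytingField }

  commutativeRing : CommutativeRing c ℓ
  commutativeRing = record { isCommutativeRing = isCommutativeRing }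

  rawRing : RawRing c ℓ
  rawRing = CommutativeRing.rawRing commutativeRing

  -- `#⇒invertible` provides an inverse of x - 0#, which is equal to x.
  inverse : ∀ x → x ≉ 0# → Carrier
  inverse x x≉0 = proj₁ (#⇒invertible x≉0)

-- A polynomial is the list of its coefficients, constant term first; trailing
-- zeros are allowed and are ignored by the equality _≈ₚ_.
module Polynomials {c ℓ} (R : RawRing c ℓ) where
  open RawRing R
  open RawSemiringDefinitions rawSemiring using () renaming (_×_ to _·_)

  infix  4 _≈ₚ_
  infixl 6 _+ₚ_
  infixl 7 _*ₚ_
  infixr 9 _∘ₚ_

  Polynomial : Set c
  Polynomial = List Carrier

  coeff : Polynomial → ℕ → Carrier
  coeff []      n       = 0#
  coeff (a ∷ p) zero    = a
  coeff (a ∷ p) (suc n) = coeff p n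

  _≈ₚ_ : Rel Polynomial ℓ
  p ≈ₚ q = ∀ n → coeff p n ≈ coeff q n

  _+ₚ_ : Op₂ Polynomial
  []      +ₚ q       = q
  (a ∷ p) +ₚ []      = a ∷ p
  (a ∷ p) +ₚ (b ∷ q) = (a + b) ∷ (p +ₚ q)

  _*ₚ_ : Op₂ Polynomial
  []      *ₚ q = []
  (a ∷ p) *ₚ q = map (a *_) q +ₚ (0# ∷ (p *ₚ q))

  _∘ₚ_ : Op₂ Polynomial
  p ∘ₚ q = foldr (λ a r → [ a ] +ₚ q *ₚ r) [] p

  eval : Polynomial → Carrier → Carrier
  eval p x = foldr (λ a r → a + x * r) 0# p

  monomial : Carrier → ℕ → Polynomial
  monomial a n = replicate n 0# ++ [ a ]

  HasDegree : Polynomial → ℕ → Set ℓ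
  HasDegree p n = ¬ (coeff p n ≈ 0#) × (∀ m → n < m → coeff p m ≈ 0#)

  -- derivativeFrom k p is the list of coefficients (k + i) · pᵢ, so that
  -- derivativeFrom 1 sends p₁ + p₂ z + p₃ z² + ⋯ to p₁ + 2 p₂ z + 3 p₃ z² + ⋯.
  derivativeFrom : ℕ → Polynomial → Polynomial
  derivativeFrom k []      = []
  derivativeFrom k (a ∷ p) = (k · a) ∷ derivativeFrom (suc k) p

  derivative : Polynomial → Polynomial
  derivative []      = []
  derivative (_ ∷ p) = derivativeFrom 1 p

-- K is a number field: an extension of ℚ of finite degree, i.e. spanned over ℚ
-- by finitely many elements.
record IsNumberField {c ℓ} (K : Field c ℓ) : Set (c ⊔ ℓ) where
  open Field K
  open RawSemiringDefinitions (RawRing.rawSemiring rawRing) using (sum)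
  field
    fromℚ              : ℚ → Carrier
    isRingHomomorphism : IsRingHomomorphism +-*-rawRing rawRing fromℚ
    size               : ℕ
    generator          : Fin size → Carrier
    spans              : ∀ x → Σ[ q ∈ (Fin size → ℚ) ] x ≈ sum (λ i → fromℚ (q i) * generator i)

record AlgebraicClosure {c ℓ} (K : Field c ℓ) c′ ℓ′ : Set (c ⊔ ℓ ⊔ lsuc (c′ ⊔ ℓ′)) where
  field
    closure : Field c′ ℓ′

  private
    module K = Field K
    module K[z] = Polynomials K.rawRing
  open Field closure
  open Polynomials rawRing

  field
    ι                   : K.Carrier → Carrier
    isRingHomomorphism  : IsRingHomomorphism K.rawRing rawRing ι
    algebraic           : ∀ x → ∃[ p ] ¬ (p K[z].≈ₚ []) × eval (map ι p) x ≈ 0#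
    algebraicallyClosed : ∀ p n → HasDegree p (suc n) → ∃[ x ] eval p x ≈ 0#

module _ {c ℓ} (F : Field c ℓ) where
  open Field F
  open Polynomials rawRing

  affine : Carrier → Carrier → Polynomial
  affine α β = β ∷ α ∷ []

  -- The inverse of z ↦ α z + β is z ↦ α⁻¹ z - α⁻¹ β.
  affine⁻¹ : (α β : Carrier) → α ≉ 0# → Polynomial
  affine⁻¹ α β α≉0 = affine (inverse α α≉0) (- (inverse α α≉0 * β))

  ConjugateOver : Polynomial → Polynomial → Set (c ⊔ ℓ)
  ConjugateOver f g =
    ∃[ α ] ∃[ β ] Σ[ α≉0 ∈ α ≉ 0# ] g ≈ₚ affine α β ∘ₚ f ∘ₚ affine⁻¹ α β α≉0

  ExactlyOneCriticalPointIn : Polynomial → Set (c ⊔ ℓ)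
  ExactlyOneCriticalPointIn f = ∃! _≈_ (λ γ → eval (derivative f) γ ≈ 0#)

module _ {c ℓ c′ ℓ′} {K : Field c ℓ} (K̄ : AlgebraicClosure K c′ ℓ′) where
  open AlgebraicClosure K̄
  open Polynomials (Field.rawRing K) using (Polynomial)

  Unicritical : Polynomial → Set (c′ ⊔ ℓ′)
  Unicritical f = ExactlyOneCriticalPointIn closure (map ι f)

  Conjugate : Polynomial → Polynomial → Set (c′ ⊔ ℓ′)
  Conjugate f g = ConjugateOver closure (map ι f) (map ι g)

{-# OPTIONS --safe #-}

-- Over an algebraically closed field of characteristic zero, a derivative whose
-- only root is γ is d a (z - γ)ᵈ⁻¹, so f = a (z - γ)ᵈ + b.  Comparing the two top
-- coefficients shows γ ∈ K, hence b = f(γ) ∈ K.  If b = γ, moving γ to 0 gives a zᵈ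
-- and a (d - 1)-st root of a rescales it to zᵈ.  Otherwise z ↦ (z - γ) / (b - γ)
-- conjugates f to a (b - γ)ᵈ⁻¹ zᵈ + 1.  Conversely, an affine φ conjugating f to some
-- A zᵈ + 1 must send γ to 0 and b to 1, and this determines A.
module Submission where

open import Defs
open import Algebra.Apartness.Bundles using (HeytingField)
open import Algebra.Bundles using (CommutativeRing)
open import Algebra.Morphism.Structures using (IsRingHomomorphism)
open import Data.List.Base using ([]; _∷_; [_]; drop; map)
open import Data.Nat.Base as ℕ using (ℕ; zero; suc; _≤_; _<_; s≤s; z≤n)
import Data.Nat.Properties as ℕ
open import Data.Product using (∃-syntax; ∃!; _×_; _,_; proj₁; proj₂)
open import Data.Rational.Base using (Positive; NonNegative)
import Data.Rational.Properties as ℚ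
open import Data.Sum.Base using (_⊎_; inj₁; inj₂)
import Relation.Binary.PropositionalEquality.Core as ≡
open import Relation.Nullary.Decidable.Core using (yes; no)
open import Relation.Nullary.Negation using (contradiction)
import Algebra.Apartness.Properties.HeytingCommutativeRing as HeytingProperties
import Algebra.Properties.CommutativeMonoid.Mult as CommutativeMonoidMult
import Algebra.Properties.CommutativeSemiring.Exp as CommutativeSemiringExp
import Algebra.Properties.Ring as RingProperties
import Algebra.Properties.Semiring.Exp as SemiringExp
import Algebra.Properties.Semiring.Mult as SemiringMult
import Algebra.Solver.Ring.NaturalCoefficients.Default as Solver
import Relation.Binary.Reasoning.Setoid as ≈-Reasoning

-- Conjugacy is a formal composition of coefficient lists, and expanding it would be painful. It is
-- tested on values instead, as `g(α y + β) = α f(y) + β`, where the inverse affine map has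
-- disappeared; over an algebraically closed field values determine coefficients, so nothing is
-- lost. Both normal forms come from one computation. With `c = - γ` and `φ(z) = α (z + c)`, the
-- conjugate of `a (z + c)ᵈ + b` is `a α¹⁻ᵈ zᵈ + α (b + c)`. The number `b + c` is `f(γ) - γ`. If it
-- is zero, `α` is free to make the leading coefficient 1; otherwise the constant term forces
-- `α = 1 / (b + c)`, which is where `a (b + c)ᵈ⁻¹` comes from. Since `a`, `b` and `c` lie in `K`,
-- so does this constant, and the case distinction is decided in `K`. Binomial coefficients are
-- avoided: only the two top coefficients of `a (z + c)ⁿ` are computed, and integrating f′ needs
-- just a relation between the coefficients of consecutive powers.

-- Arithmetic in a field.

module FieldProperties {c ℓ} (F : Field c ℓ) where
  open Field F public
  open CommutativeRing commutativeRing public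
    hiding (Carrier; _≈_; _≉_; _+_; _*_; -_; 0#; 1#; rawRing; isCommutativeRing)
  open HeytingProperties (HeytingField.heytingCommutativeRing heytingField) public
    using (x-0≈x; 1#0)
  open RingProperties ring public
    using (+-cancelˡ; -1*x≈-x) renaming (x∙y⁻¹≈ε⇒x≈y to x-y≈0⇒x≈y)
  open SemiringMult semiring public
    using (×-congʳ; ×-assoc-*; ×-comm-*) renaming (_×_ to _·_)
  open CommutativeMonoidMult +-commutativeMonoid public using (×-distrib-+)
  open SemiringExp semiring public using (_^_; ^-congˡ)
  open CommutativeSemiringExp commutativeSemiring public using (^-distrib-*)
  open Solver commutativeSemiring public using (solve; _:=_; _:+_; _:*_; con)
  module Reasoning = ≈-Reasoning setoid
  open Reasoning

  inverseˡ : ∀ {x} (x≉0 : x ≉ 0#) → inverse x x≉0 * x ≈ 1#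
  inverseˡ x≉0 =
    trans (*-congˡ (sym (x-0≈x _))) (proj₁ (proj₂ (#⇒invertible x≉0)))

  inverseʳ : ∀ {x} (x≉0 : x ≉ 0#) → x * inverse x x≉0 ≈ 1#
  inverseʳ x≉0 = trans (*-comm _ _) (inverseˡ x≉0)

  *-cancelˡ-nonZero : ∀ {x y z} → x ≉ 0# → x * y ≈ x * z → y ≈ z
  *-cancelˡ-nonZero {x} {y} {z} x≉0 xy≈xz = begin
    y                        ≈⟨ *-identityˡ y ⟨
    1# * y                   ≈⟨ *-congʳ (inverseˡ x≉0) ⟨
    (inverse x x≉0 * x) * y  ≈⟨ *-assoc _ _ _ ⟩
    inverse x x≉0 * (x * y)  ≈⟨ *-congˡ xy≈xz ⟩
    inverse x x≉0 * (x * z)  ≈⟨ *-assoc _ _ _ ⟨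
    (inverse x x≉0 * x) * z  ≈⟨ *-congʳ (inverseˡ x≉0) ⟩
    1# * z                   ≈⟨ *-identityˡ z ⟩
    z                        ∎

  *-nonZero : ∀ {x y} → x ≉ 0# → y ≉ 0# → x * y ≉ 0#
  *-nonZero x≉0 y≉0 xy≈0 = y≉0 (*-cancelˡ-nonZero x≉0 (trans xy≈0 (sym (zeroʳ _))))

  invertible⇒nonZero : ∀ {x y} → x * y ≈ 1# → x ≉ 0#
  invertible⇒nonZero xy≈1 x≈0 =
    1#0 (trans (sym xy≈1) (trans (*-congʳ x≈0) (zeroˡ _)))

  ^-nonZero : ∀ {x} n → x ≉ 0# → x ^ n ≉ 0#
  ^-nonZero zero    x≉0 = 1#0
  ^-nonZero (suc n) x≉0 = *-nonZero x≉0 (^-nonZero n x≉0)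

  1^n≈1 : ∀ n → 1# ^ n ≈ 1#
  1^n≈1 zero    = refl
  1^n≈1 (suc n) = trans (*-identityˡ _) (1^n≈1 n)

  ·-zeroʳ : ∀ n → n · 0# ≈ 0#
  ·-zeroʳ zero    = refl
  ·-zeroʳ (suc n) = trans (+-identityˡ _) (·-zeroʳ n)

  CharacteristicZero : Set ℓ
  CharacteristicZero = ∀ n → suc n · 1# ≉ 0#

  -- The multiple `suc n · x` is the product of `x` with the nonzero field element `suc n · 1#`.
  -- Every later comparison of coefficients uses characteristic zero through this cancellation.
  ·-cancelˡ : CharacteristicZero → ∀ n {x y} → suc n · x ≈ suc n · y → x ≈ y
  ·-cancelˡ char0 n {x} {y} nx≈ny = *-cancelˡ-nonZero (char0 n) (begin
    (suc n · 1#) * x  ≈⟨ unscale x ⟩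
    suc n · x         ≈⟨ nx≈ny ⟩
    suc n · y         ≈⟨ unscale y ⟨
    (suc n · 1#) * y  ∎)
    where
    unscale : ∀ z → (suc n · 1#) * z ≈ suc n · z
    unscale z = trans (×-assoc-* (suc n) 1# z) (×-congʳ (suc n) (*-identityˡ z))

-- Homomorphisms of fields.

module FieldHomomorphism {c ℓ c′ ℓ′} (E : Field c ℓ) (F : Field c′ ℓ′)
  (φ : Field.Carrier E → Field.Carrier F)
  (isHomomorphism : IsRingHomomorphism (Field.rawRing E) (Field.rawRing F) φ) where
  private
    module E = FieldProperties E
    module E[z] = Polynomials E.rawRing
  open FieldProperties F
  open Polynomials rawRing
  open IsRingHomomorphism isHomomorphism public
    using (⟦⟧-cong; +-homo; *-homo; 0#-homo; 1#-homo; -‿homo)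
  open Reasoning

  -- An inverse is carried to an inverse, and an invertible element cannot be `0#`.
  nonZero-homo : ∀ {x} → x E.≉ E.0# → φ x ≉ 0#
  nonZero-homo {x} x≉0 = invertible⇒nonZero (begin
    φ x * φ (E.inverse x x≉0)  ≈⟨ *-homo _ _ ⟨
    φ (x E.* E.inverse x x≉0)  ≈⟨ ⟦⟧-cong (E.inverseʳ x≉0) ⟩
    φ E.1#                     ≈⟨ 1#-homo ⟩
    1#                         ∎)

  -- The kernel is trivial by `nonZero-homo`; decidable equality in `E` makes this a positive
  -- statement. It brings equalities found in the closure back to `K`.
  injective : ∀ {x y} → φ x ≈ φ y → x E.≈ y
  injective {x} {y} φx≈φy with (x E.- y) E.≟ E.0#
  ... | yes x-y≈0 = E.x-y≈0⇒x≈y x y x-y≈0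
  ... | no  x-y≉0 = contradiction (begin
    φ (x E.- y)      ≈⟨ +-homo _ _ ⟩
    φ x + φ (E.- y)  ≈⟨ +-cong φx≈φy (-‿homo y) ⟩
    φ y - φ y        ≈⟨ -‿inverseʳ _ ⟩
    0#               ∎) (nonZero-homo x-y≉0)

  ·-homo : ∀ n x → φ (n E.· x) ≈ n · φ x
  ·-homo zero    x = 0#-homo
  ·-homo (suc n) x = trans (+-homo _ _) (+-congˡ (·-homo n x))

  ^-homo : ∀ x n → φ (x E.^ n) ≈ φ x ^ n
  ^-homo x zero    = 1#-homo
  ^-homo x (suc n) = trans (*-homo _ _) (*-congˡ (^-homo x n))

  characteristicZero : E.CharacteristicZero → CharacteristicZero
  characteristicZero char0 n n·1≈0 = nonZero-homo (char0 n) (begin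
    φ (suc n E.· E.1#)  ≈⟨ ·-homo (suc n) E.1# ⟩
    suc n · φ E.1#      ≈⟨ ×-congʳ (suc n) 1#-homo ⟩
    suc n · 1#          ≈⟨ n·1≈0 ⟩
    0#                  ∎)

  coeff-map : ∀ p n → coeff (map φ p) n ≈ φ (E[z].coeff p n)
  coeff-map []      n       = sym 0#-homo
  coeff-map (a ∷ p) zero    = refl
  coeff-map (a ∷ p) (suc n) = coeff-map p n

  eval-map : ∀ p x → eval (map φ p) (φ x) ≈ φ (E[z].eval p x)
  eval-map []      x = sym 0#-homo
  eval-map (a ∷ p) x = begin
    φ a + φ x * eval (map φ p) (φ x)   ≈⟨ +-congˡ (*-congˡ (eval-map p x)) ⟩
    φ a + φ x * φ (E[z].eval p x)      ≈⟨ +-congˡ (*-homo _ _) ⟨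
    φ a + φ (x E.* E[z].eval p x)      ≈⟨ +-homo _ _ ⟨
    φ (a E.+ x E.* E[z].eval p x)      ∎

  map-cong-≈ₚ : ∀ {p q} → p E[z].≈ₚ q → map φ p ≈ₚ map φ q
  map-cong-≈ₚ {p} {q} p≈q n =
    trans (coeff-map p n) (trans (⟦⟧-cong (p≈q n)) (sym (coeff-map q n)))

-- Characteristic zero of ℚ.

ℚ-field : Field _ _
ℚ-field = record { isHeytingField = ℚ.isHeytingField ; _≟_ = ℚ._≟_ }

-- Proved through the order of ℚ: `1#` plus a nonnegative multiple of itself is positive, hence not
-- zero.
ℚ-characteristicZero : FieldProperties.CharacteristicZero ℚ-field
ℚ-characteristicZero n n·1≡0 =
  ℚ.<-irrefl (≡.sym n·1≡0) (ℚ.positive⁻¹ (suc n · 1#) {{positive n}})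
  where
  open FieldProperties ℚ-field
  positive    : ∀ n → Positive (suc n · 1#)
  nonNegative : ∀ n → NonNegative (n · 1#)
  positive n = ℚ.pos+nonNeg⇒pos 1# (n · 1#) {{nonNegative n}}
  nonNegative zero    = _
  nonNegative (suc n) = ℚ.pos⇒nonNeg (suc n · 1#) {{positive n}}

-- Coefficients and values of polynomials.

module PolynomialProperties {c ℓ} (F : Field c ℓ) where
  open FieldProperties F
  open Polynomials rawRing public
  open Reasoning

  coeff-+ₚ : ∀ p q n → coeff (p +ₚ q) n ≈ coeff p n + coeff q n
  coeff-+ₚ []      q       n       = sym (+-identityˡ _)
  coeff-+ₚ (a ∷ p) []      n       = sym (+-identityʳ _)
  coeff-+ₚ (a ∷ p) (b ∷ q) zero    = refl
  coeff-+ₚ (a ∷ p) (b ∷ q) (suc n) = coeff-+ₚ p q n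

  coeff-scale : ∀ a p n → coeff (map (a *_) p) n ≈ a * coeff p n
  coeff-scale a []      n       = sym (zeroʳ a)
  coeff-scale a (b ∷ p) zero    = refl
  coeff-scale a (b ∷ p) (suc n) = coeff-scale a p n

  coeff-derivativeFrom : ∀ k p n →
    coeff (derivativeFrom k p) n ≈ (k ℕ.+ n) · coeff p n
  coeff-derivativeFrom k []      n       = sym (·-zeroʳ (k ℕ.+ n))
  coeff-derivativeFrom k (a ∷ p) zero    rewrite ℕ.+-identityʳ k = refl
  coeff-derivativeFrom k (a ∷ p) (suc n) rewrite ℕ.+-suc k n =
    coeff-derivativeFrom (suc k) p n

  coeff-derivative : ∀ p n → coeff (derivative p) n ≈ suc n · coeff p (suc n)
  coeff-derivative []      n = sym (·-zeroʳ (suc n))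
  coeff-derivative (a ∷ p) n = coeff-derivativeFrom 1 p n

  -- The top coefficient is multiplied by `suc n`, which cannot annihilate it in characteristic
  -- zero.
  derivative-degree : CharacteristicZero → ∀ {p n} →
    HasDegree p (suc n) → HasDegree (derivative p) n
  derivative-degree char0 {p} {n} (pₙ≉0 , p>n≈0) =
    (λ p′ₙ≈0 → pₙ≉0 (·-cancelˡ char0 n
      (trans (sym (coeff-derivative p n)) (trans p′ₙ≈0 (sym (·-zeroʳ (suc n))))))) ,
    (λ m n<m → trans (coeff-derivative p m)
      (trans (×-congʳ (suc m) (p>n≈0 (suc m) (s≤s n<m))) (·-zeroʳ (suc m))))

  eval-≈0 : ∀ p x → p ≈ₚ [] → eval p x ≈ 0#
  eval-≈0 []      x p≈0 = refl
  eval-≈0 (a ∷ p) x p≈0 = begin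
    a + x * eval p x  ≈⟨ +-cong (p≈0 0) (*-congˡ (eval-≈0 p x (λ n → p≈0 (suc n)))) ⟩
    0# + x * 0#       ≈⟨ solve 1 (λ x → con 0 :+ x :* con 0 := con 0) refl x ⟩
    0#                ∎

  eval-cong : ∀ p q x → p ≈ₚ q → eval p x ≈ eval q x
  eval-cong []      q       x p≈q = sym (eval-≈0 q x (λ n → sym (p≈q n)))
  eval-cong (a ∷ p) []      x p≈q = eval-≈0 (a ∷ p) x p≈q
  eval-cong (a ∷ p) (b ∷ q) x p≈q =
    +-cong (p≈q 0) (*-congˡ (eval-cong p q x (λ n → p≈q (suc n))))

  eval-congʳ : ∀ p {x y} → x ≈ y → eval p x ≈ eval p y
  eval-congʳ []      x≈y = refl
  eval-congʳ (a ∷ p) x≈y = +-congˡ (*-cong x≈y (eval-congʳ p x≈y))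

  eval-constant : ∀ p x → (∀ n → coeff p (suc n) ≈ 0#) → eval p x ≈ coeff p 0
  eval-constant []      x p≈p₀ = refl
  eval-constant (a ∷ p) x p≈p₀ =
    trans (+-congˡ (trans (*-congˡ (eval-≈0 p x p≈p₀)) (zeroʳ x))) (+-identityʳ a)

  eval-[] : ∀ a x → eval [ a ] x ≈ a
  eval-[] a x = eval-constant [ a ] x (λ _ → refl)

  eval-+ₚ : ∀ p q x → eval (p +ₚ q) x ≈ eval p x + eval q x
  eval-+ₚ []      q       x = sym (+-identityˡ _)
  eval-+ₚ (a ∷ p) []      x = sym (+-identityʳ _)
  eval-+ₚ (a ∷ p) (b ∷ q) x = begin
    a + b + x * eval (p +ₚ q) x              ≈⟨ +-congˡ (*-congˡ (eval-+ₚ p q x)) ⟩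
    a + b + x * (eval p x + eval q x)        ≈⟨ solve 5 (λ a b x y z →
      a :+ b :+ x :* (y :+ z) := (a :+ x :* y) :+ (b :+ x :* z)) refl a b x _ _ ⟩
    (a + x * eval p x) + (b + x * eval q x)  ∎

  eval-scale : ∀ a p x → eval (map (a *_) p) x ≈ a * eval p x
  eval-scale a []      x = sym (zeroʳ a)
  eval-scale a (b ∷ p) x = begin
    a * b + x * eval (map (a *_) p) x  ≈⟨ +-congˡ (*-congˡ (eval-scale a p x)) ⟩
    a * b + x * (a * eval p x)         ≈⟨ solve 4 (λ a b x y →
      a :* b :+ x :* (a :* y) := a :* (b :+ x :* y)) refl a b x _ ⟩
    a * (b + x * eval p x)             ∎

  eval-*ₚ : ∀ p q x → eval (p *ₚ q) x ≈ eval p x * eval q x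
  eval-*ₚ []      q x = sym (zeroˡ _)
  eval-*ₚ (a ∷ p) q x = begin
    eval (map (a *_) q +ₚ (0# ∷ p *ₚ q)) x
      ≈⟨ eval-+ₚ (map (a *_) q) (0# ∷ p *ₚ q) x ⟩
    eval (map (a *_) q) x + (0# + x * eval (p *ₚ q) x)
      ≈⟨ +-cong (eval-scale a q x) (+-congˡ (*-congˡ (eval-*ₚ p q x))) ⟩
    a * eval q x + (0# + x * (eval p x * eval q x))
      ≈⟨ solve 4 (λ a x y z → a :* z :+ (con 0 :+ x :* (y :* z)) := (a :+ x :* y) :* z)
           refl a x _ _ ⟩
    (a + x * eval p x) * eval q x ∎

  eval-∘ₚ : ∀ p q x → eval (p ∘ₚ q) x ≈ eval p (eval q x)
  eval-∘ₚ []      q x = refl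
  eval-∘ₚ (a ∷ p) q x = begin
    eval ([ a ] +ₚ q *ₚ p ∘ₚ q) x          ≈⟨ eval-+ₚ [ a ] (q *ₚ p ∘ₚ q) x ⟩
    eval [ a ] x + eval (q *ₚ p ∘ₚ q) x    ≈⟨ +-cong (eval-[] a x) (eval-*ₚ q (p ∘ₚ q) x) ⟩
    a + eval q x * eval (p ∘ₚ q) x         ≈⟨ +-congˡ (*-congˡ (eval-∘ₚ p q x)) ⟩
    a + eval q x * eval p (eval q x)       ∎

  coeff-monomial-top : ∀ a n → coeff (monomial a n) n ≈ a
  coeff-monomial-top a zero    = refl
  coeff-monomial-top a (suc n) = coeff-monomial-top a n

  coeff-monomial-above : ∀ a n m → n < m → coeff (monomial a n) m ≈ 0#
  coeff-monomial-above a zero    (suc m) _         = refl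
  coeff-monomial-above a (suc n) (suc m) (s≤s n<m) = coeff-monomial-above a n m n<m

  eval-monomial : ∀ a n x → eval (monomial a n) x ≈ a * x ^ n
  eval-monomial a zero    x = trans (eval-[] a x) (sym (*-identityʳ a))
  eval-monomial a (suc n) x = begin
    0# + x * eval (monomial a n) x  ≈⟨ +-congˡ (*-congˡ (eval-monomial a n x)) ⟩
    0# + x * (a * x ^ n)            ≈⟨ solve 3 (λ a x y →
      con 0 :+ x :* (a :* y) := a :* (x :* y)) refl a x _ ⟩
    a * (x * x ^ n)                 ∎

  monomial-cong : ∀ {a b} n → a ≈ b → monomial a n ≈ₚ monomial b n
  monomial-cong zero    a≈b zero    = a≈b
  monomial-cong zero    a≈b (suc m) = refl
  monomial-cong (suc n) a≈b zero    = refl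
  monomial-cong (suc n) a≈b (suc m) = monomial-cong n a≈b m

  +ₚ-congʳ : ∀ {p q} r → p ≈ₚ q → p +ₚ r ≈ₚ q +ₚ r
  +ₚ-congʳ {p} {q} r p≈q n =
    trans (coeff-+ₚ p r n) (trans (+-congʳ (p≈q n)) (sym (coeff-+ₚ q r n)))

  -- Powers of a linear polynomial.

  -- (z + c) p.  Writing z - γ as z + c with c = - γ leaves only semiring identities.
  infixr 7 _⊹_
  _⊹_ : Carrier → Polynomial → Polynomial
  c ⊹ p = (c ∷ 1# ∷ []) *ₚ p

  coeff-⊹-zero : ∀ c p → coeff (c ⊹ p) 0 ≈ c * coeff p 0
  coeff-⊹-zero c p = begin
    coeff (c ⊹ p) 0                   ≈⟨ coeff-+ₚ (map (c *_) p) _ 0 ⟩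
    coeff (map (c *_) p) 0 + 0#       ≈⟨ +-identityʳ _ ⟩
    coeff (map (c *_) p) 0            ≈⟨ coeff-scale c p 0 ⟩
    c * coeff p 0                     ∎

  coeff-⊹-suc : ∀ c p n → coeff (c ⊹ p) (suc n) ≈ c * coeff p (suc n) + coeff p n
  coeff-⊹-suc c p n = begin
    coeff (c ⊹ p) (suc n)
      ≈⟨ coeff-+ₚ (map (c *_) p) _ (suc n) ⟩
    coeff (map (c *_) p) (suc n) + coeff (map (1# *_) p +ₚ [ 0# ]) n
      ≈⟨ +-cong (coeff-scale c p (suc n)) (coeff-+ₚ (map (1# *_) p) [ 0# ] n) ⟩
    c * coeff p (suc n) + (coeff (map (1# *_) p) n + coeff [ 0# ] n)
      ≈⟨ +-congˡ (+-cong (coeff-scale 1# p n) (coeff-[0] n)) ⟩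
    c * coeff p (suc n) + (1# * coeff p n + 0#)
      ≈⟨ +-congˡ (solve 1 (λ x → con 1 :* x :+ con 0 := x) refl _) ⟩
    c * coeff p (suc n) + coeff p n ∎
    where
    coeff-[0] : ∀ n → coeff [ 0# ] n ≈ 0#
    coeff-[0] zero    = refl
    coeff-[0] (suc n) = refl

  eval-⊹ : ∀ c p x → eval (c ⊹ p) x ≈ (x + c) * eval p x
  eval-⊹ c p x = begin
    eval (c ⊹ p) x                      ≈⟨ eval-*ₚ (c ∷ 1# ∷ []) p x ⟩
    (c + x * (1# + x * 0#)) * eval p x  ≈⟨ solve 3 (λ c x y →
      (c :+ x :* (con 1 :+ x :* con 0)) :* y := (x :+ c) :* y) refl c x _ ⟩
    (x + c) * eval p x                  ∎

  ⊹-cong : ∀ c {p q} → p ≈ₚ q → c ⊹ p ≈ₚ c ⊹ q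
  ⊹-cong c {p} {q} p≈q zero =
    trans (coeff-⊹-zero c p) (trans (*-congˡ (p≈q 0)) (sym (coeff-⊹-zero c q)))
  ⊹-cong c {p} {q} p≈q (suc n) = trans (coeff-⊹-suc c p n)
    (trans (+-cong (*-congˡ (p≈q (suc n))) (p≈q n)) (sym (coeff-⊹-suc c q n)))

  -- a (z + c)ⁿ
  linearPower : Carrier → Carrier → ℕ → Polynomial
  linearPower a c zero    = [ a ]
  linearPower a c (suc n) = c ⊹ linearPower a c n

  eval-linearPower : ∀ a c n x → eval (linearPower a c n) x ≈ a * (x + c) ^ n
  eval-linearPower a c zero    x = trans (eval-[] a x) (sym (*-identityʳ a))
  eval-linearPower a c (suc n) x = begin
    eval (c ⊹ linearPower a c n) x           ≈⟨ eval-⊹ c (linearPower a c n) x ⟩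
    (x + c) * eval (linearPower a c n) x     ≈⟨ *-congˡ (eval-linearPower a c n x) ⟩
    (x + c) * (a * (x + c) ^ n)              ≈⟨ solve 3 (λ a y z →
      y :* (a :* z) := a :* (y :* z)) refl a _ _ ⟩
    a * ((x + c) * (x + c) ^ n)              ∎

  coeff-linearPower-above : ∀ a c n m → n < m → coeff (linearPower a c n) m ≈ 0#
  coeff-linearPower-above a c zero    (suc m) _         = refl
  coeff-linearPower-above a c (suc n) (suc m) (s≤s n<m) = begin
    coeff (linearPower a c (suc n)) (suc m)
      ≈⟨ coeff-⊹-suc c (linearPower a c n) m ⟩
    c * coeff (linearPower a c n) (suc m) + coeff (linearPower a c n) m
      ≈⟨ +-cong (*-congˡ (coeff-linearPower-above a c n (suc m) (ℕ.m<n⇒m<1+n n<m)))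
                (coeff-linearPower-above a c n m n<m) ⟩
    c * 0# + 0#
      ≈⟨ solve 1 (λ c → c :* con 0 :+ con 0 := con 0) refl c ⟩
    0# ∎

  coeff-linearPower-top : ∀ a c n → coeff (linearPower a c n) n ≈ a
  coeff-linearPower-top a c zero    = refl
  coeff-linearPower-top a c (suc n) = begin
    coeff (linearPower a c (suc n)) (suc n)
      ≈⟨ coeff-⊹-suc c (linearPower a c n) n ⟩
    c * coeff (linearPower a c n) (suc n) + coeff (linearPower a c n) n
      ≈⟨ +-cong (*-congˡ (coeff-linearPower-above a c n (suc n) (ℕ.n<1+n n)))
                (coeff-linearPower-top a c n) ⟩
    c * 0# + a
      ≈⟨ solve 2 (λ c a → c :* con 0 :+ a := a) refl c a ⟩
    a ∎

  -- Each further factor `z + c` contributes `c` times the top coefficient `a`, so `a * c` is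
  -- counted once per factor. From this coefficient `c` is later recovered.
  coeff-linearPower-subtop : ∀ a c n →
    coeff (linearPower a c (suc n)) n ≈ suc n · (a * c)
  coeff-linearPower-subtop a c zero = begin
    coeff (linearPower a c 1) 0  ≈⟨ coeff-⊹-zero c [ a ] ⟩
    c * a                        ≈⟨ solve 2 (λ c a → c :* a := a :* c :+ con 0) refl c a ⟩
    1 · (a * c)                  ∎
  coeff-linearPower-subtop a c (suc n) = begin
    coeff (linearPower a c (suc (suc n))) (suc n)
      ≈⟨ coeff-⊹-suc c (linearPower a c (suc n)) n ⟩
    c * coeff (linearPower a c (suc n)) (suc n) + coeff (linearPower a c (suc n)) n
      ≈⟨ +-cong (trans (*-comm _ _) (*-congʳ (coeff-linearPower-top a c (suc n))))
                (coeff-linearPower-subtop a c n) ⟩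
    a * c + suc n · (a * c) ∎

  linearPower-cong : ∀ {a b} c n → a ≈ b → linearPower a c n ≈ₚ linearPower b c n
  linearPower-cong c zero    a≈b zero    = a≈b
  linearPower-cong c zero    a≈b (suc m) = refl
  linearPower-cong {a} {b} c (suc n) a≈b =
    ⊹-cong c {linearPower a c n} {linearPower b c n} (linearPower-cong c n a≈b)

  -- Separates the leading coefficient `d · a` of a derivative into the factor `d` and a power with
  -- leading coefficient `a`.
  coeff-linearPower-· : ∀ k a c n m →
    coeff (linearPower (k · a) c n) m ≈ k · coeff (linearPower a c n) m
  coeff-linearPower-· k a c zero    zero    = refl
  coeff-linearPower-· k a c zero    (suc m) = sym (·-zeroʳ k)
  coeff-linearPower-· k a c (suc n) zero    = begin
    coeff (linearPower (k · a) c (suc n)) 0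
      ≈⟨ coeff-⊹-zero c (linearPower (k · a) c n) ⟩
    c * coeff (linearPower (k · a) c n) 0
      ≈⟨ *-congˡ (coeff-linearPower-· k a c n 0) ⟩
    c * (k · coeff (linearPower a c n) 0)
      ≈⟨ ×-comm-* k c _ ⟩
    k · (c * coeff (linearPower a c n) 0)
      ≈⟨ ×-congʳ k (coeff-⊹-zero c (linearPower a c n)) ⟨
    k · coeff (linearPower a c (suc n)) 0 ∎
  coeff-linearPower-· k a c (suc n) (suc m) = begin
    coeff (linearPower (k · a) c (suc n)) (suc m)
      ≈⟨ coeff-⊹-suc c (linearPower (k · a) c n) m ⟩
    c * coeff (linearPower (k · a) c n) (suc m) + coeff (linearPower (k · a) c n) m
      ≈⟨ +-cong (*-congˡ (coeff-linearPower-· k a c n (suc m)))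
                (coeff-linearPower-· k a c n m) ⟩
    c * (k · coeff (linearPower a c n) (suc m)) + k · coeff (linearPower a c n) m
      ≈⟨ +-congʳ (×-comm-* k c _) ⟩
    k · (c * coeff (linearPower a c n) (suc m)) + k · coeff (linearPower a c n) m
      ≈⟨ ×-distrib-+ _ _ k ⟨
    k · (c * coeff (linearPower a c n) (suc m) + coeff (linearPower a c n) m)
      ≈⟨ ×-congʳ k (coeff-⊹-suc c (linearPower a c n) m) ⟨
    k · coeff (linearPower a c (suc n)) (suc m) ∎

  -- The coefficientwise form of (a (z + c)ⁿ⁺¹)′ = (n + 1) a (z + c)ⁿ.
  coeff-linearPower-suc : ∀ a c n k →
    suc k · coeff (linearPower a c (suc n)) (suc k) ≈ suc n · coeff (linearPower a c n) k
  coeff-linearPower-suc a c zero zero =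
    ×-congʳ 1 (trans (coeff-⊹-suc c [ a ] 0) (trans (+-congʳ (zeroʳ c)) (+-identityˡ a)))
  coeff-linearPower-suc a c zero (suc k) =
    trans (×-congʳ (suc (suc k)) (coeff-linearPower-above a c 1 (suc (suc k)) (s≤s (s≤s z≤n))))
          (trans (·-zeroʳ (suc (suc k))) (sym (·-zeroʳ 1)))
  coeff-linearPower-suc a c (suc n) k = begin
    suc k · coeff (linearPower a c (suc (suc n))) (suc k)
      ≈⟨ ×-congʳ (suc k) (coeff-⊹-suc c (linearPower a c (suc n)) k) ⟩
    suc k · (c * coeff (linearPower a c (suc n)) (suc k) + pₖ)
      ≈⟨ ×-distrib-+ _ _ (suc k) ⟩
    suc k · (c * coeff (linearPower a c (suc n)) (suc k)) + suc k · pₖ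
      ≈⟨ +-congʳ (×-comm-* (suc k) c _) ⟨
    c * (suc k · coeff (linearPower a c (suc n)) (suc k)) + suc k · pₖ
      ≈⟨ +-congʳ (*-congˡ (coeff-linearPower-suc a c n k)) ⟩
    c * (suc n · coeff (linearPower a c n) k) + (pₖ + k · pₖ)
      ≈⟨ +-congʳ (×-comm-* (suc n) c _) ⟩
    suc n · (c * coeff (linearPower a c n) k) + (pₖ + k · pₖ)
      ≈⟨ solve 3 (λ x y z → x :+ (y :+ z) := y :+ (x :+ z)) refl _ _ _ ⟩
    pₖ + (suc n · (c * coeff (linearPower a c n) k) + k · pₖ)
      ≈⟨ +-congˡ (lower k) ⟩
    pₖ + suc n · pₖ ∎
    where
    pₖ = coeff (linearPower a c (suc n)) k
    -- Coefficientwise `(z + c) P′ = (n + 1) P` for `P = a (z + c)ⁿ⁺¹`. The term `k · pₖ` is the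
    -- coefficient of `z P′`; it vanishes at `k = 0`, and at `suc k` the induction hypothesis on `n`
    -- applies.
    lower : ∀ k →
      suc n · (c * coeff (linearPower a c n) k) + k · coeff (linearPower a c (suc n)) k
      ≈ suc n · coeff (linearPower a c (suc n)) k
    lower zero    = trans (+-identityʳ _)
      (×-congʳ (suc n) (sym (coeff-⊹-zero c (linearPower a c n))))
    lower (suc k) = begin
      suc n · (c * coeff (linearPower a c n) (suc k))
        + suc k · coeff (linearPower a c (suc n)) (suc k)
        ≈⟨ +-congˡ (coeff-linearPower-suc a c n k) ⟩
      suc n · (c * coeff (linearPower a c n) (suc k)) + suc n · coeff (linearPower a c n) k
        ≈⟨ ×-distrib-+ _ _ (suc n) ⟨
      suc n · (c * coeff (linearPower a c n) (suc k) + coeff (linearPower a c n) k)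
        ≈⟨ ×-congʳ (suc n) (coeff-⊹-suc c (linearPower a c n) k) ⟨
      suc n · coeff (linearPower a c (suc n)) (suc k) ∎

  -- Division by a linear factor, and degrees.

  -- The quotient of p by z - γ.
  quotient : Carrier → Polynomial → Polynomial
  quotient γ []      = []
  quotient γ (a ∷ p) = eval p γ ∷ quotient γ p

  -- Synthetic division: the intermediate results of Horner evaluation at γ are the coefficients of
  -- the quotient.
  coeff-quotient : ∀ γ p n → coeff (quotient γ p) n ≈ eval (drop (suc n) p) γ
  coeff-quotient γ []      n       = refl
  coeff-quotient γ (a ∷ p) zero    = refl
  coeff-quotient γ (a ∷ p) (suc n) = coeff-quotient γ p n

  coeff-drop : ∀ k p n → coeff (drop k p) n ≈ coeff p (k ℕ.+ n)
  coeff-drop zero    p       n = refl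
  coeff-drop (suc k) []      n = refl
  coeff-drop (suc k) (a ∷ p) n = coeff-drop k p n

  -- From index `n` on, the tail of `p` that gives the coefficient of the quotient is constant, so
  -- its value does not depend on γ.
  quotient-degree : ∀ γ {p n} → HasDegree p (suc n) → HasDegree (quotient γ p) n
  quotient-degree γ {p} {n} (pₙ≉0 , p>n≈0) =
    (λ qₙ≈0 → pₙ≉0 (trans (sym (from-n n ℕ.≤-refl)) qₙ≈0)) ,
    (λ m n<m → trans (from-n m (ℕ.<⇒≤ n<m)) (p>n≈0 (suc m) (s≤s n<m)))
    where
    from-n : ∀ m → n ≤ m → coeff (quotient γ p) m ≈ coeff p (suc m)
    from-n m n≤m = begin
      coeff (quotient γ p) m      ≈⟨ coeff-quotient γ p m ⟩
      eval (drop (suc m) p) γ     ≈⟨ eval-constant (drop (suc m) p) γ (λ k →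
        trans (coeff-drop (suc m) p (suc k))
              (p>n≈0 _ (s≤s (ℕ.≤-<-trans n≤m (ℕ.m<m+n m (s≤s z≤n)))))) ⟩
      coeff (drop (suc m) p) 0    ≈⟨ coeff-drop (suc m) p 0 ⟩
      coeff p (suc m ℕ.+ 0)       ≡⟨ ≡.cong (coeff p) (ℕ.+-identityʳ (suc m)) ⟩
      coeff p (suc m)             ∎

  -- The remainder is kept because the induction runs over tails of `p`, which need not vanish at γ:
  -- the remainder of the tail becomes the constant coefficient of the next quotient.
  ⊹-quotient : ∀ {γ c} → γ + c ≈ 0# → ∀ p →
    p ≈ₚ (c ⊹ quotient γ p) +ₚ [ eval p γ ]
  ⊹-quotient {γ} {c} γ+c≈0 p n = trans (go p n) (sym (coeff-+ₚ (c ⊹ quotient γ p) _ n))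
    where
    go : ∀ p n → coeff p n ≈ coeff (c ⊹ quotient γ p) n + coeff [ eval p γ ] n
    go [] zero = sym (trans (+-identityʳ _) (trans (coeff-⊹-zero c []) (zeroʳ c)))
    go [] (suc n) = sym (trans (+-identityʳ _) (trans (coeff-⊹-suc c [] n)
      (trans (+-identityʳ _) (zeroʳ c))))
    go (a ∷ p) zero = sym (begin
      coeff (c ⊹ quotient γ (a ∷ p)) 0 + (a + γ * eval p γ)
        ≈⟨ +-congʳ (coeff-⊹-zero c (quotient γ (a ∷ p))) ⟩
      c * eval p γ + (a + γ * eval p γ)
        ≈⟨ solve 4 (λ c a γ y → c :* y :+ (a :+ γ :* y) := a :+ (γ :+ c) :* y) refl c a γ _ ⟩
      a + (γ + c) * eval p γ
        ≈⟨ +-congˡ (trans (*-congʳ γ+c≈0) (zeroˡ _)) ⟩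
      a + 0#
        ≈⟨ +-identityʳ a ⟩
      a ∎)
    go (a ∷ p) (suc n) = begin
      coeff p n
        ≈⟨ go p n ⟩
      coeff (c ⊹ quotient γ p) n + coeff [ eval p γ ] n
        ≈⟨ shift n ⟩
      c * coeff (quotient γ p) n + coeff (eval p γ ∷ quotient γ p) n
        ≈⟨ coeff-⊹-suc c (quotient γ (a ∷ p)) n ⟨
      coeff (c ⊹ quotient γ (a ∷ p)) (suc n)
        ≈⟨ +-identityʳ _ ⟨
      coeff (c ⊹ quotient γ (a ∷ p)) (suc n) + 0# ∎
      where
      shift : ∀ n → coeff (c ⊹ quotient γ p) n + coeff [ eval p γ ] n
        ≈ c * coeff (quotient γ p) n + coeff (eval p γ ∷ quotient γ p) n
      shift zero    = +-congʳ (coeff-⊹-zero c (quotient γ p))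
      shift (suc n) = trans (+-identityʳ _) (coeff-⊹-suc c (quotient γ p) n)

  root⇒factor : ∀ {γ c} → γ + c ≈ 0# → ∀ p → eval p γ ≈ 0# → p ≈ₚ c ⊹ quotient γ p
  root⇒factor {γ} {c} γ+c≈0 p pγ≈0 n = begin
    coeff p n                                         ≈⟨ ⊹-quotient γ+c≈0 p n ⟩
    coeff ((c ⊹ quotient γ p) +ₚ [ eval p γ ]) n      ≈⟨ coeff-+ₚ (c ⊹ quotient γ p) _ n ⟩
    coeff (c ⊹ quotient γ p) n + coeff [ eval p γ ] n ≈⟨ +-congˡ (constant n) ⟩
    coeff (c ⊹ quotient γ p) n + 0#                   ≈⟨ +-identityʳ _ ⟩
    coeff (c ⊹ quotient γ p) n                        ∎
    where
    constant : ∀ n → coeff [ eval p γ ] n ≈ 0#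
    constant zero    = pγ≈0
    constant (suc n) = refl

  -- Lists may end in zeros, so their length does not give the degree. The tail is examined first;
  -- the head is tested only when the tail vanishes.
  zero⊎degree : ∀ p → p ≈ₚ [] ⊎ ∃[ n ] HasDegree p n
  zero⊎degree [] = inj₁ (λ _ → refl)
  zero⊎degree (a ∷ p) with zero⊎degree p | a ≟ 0#
  ... | inj₂ (n , pₙ≉0 , p>n≈0) | _ =
    inj₂ (suc n , pₙ≉0 , λ { (suc m) (s≤s n<m) → p>n≈0 m n<m })
  ... | inj₁ p≈0 | no a≉0  = inj₂ (0 , a≉0 , λ { (suc m) _ → p≈0 m })
  ... | inj₁ p≈0 | yes a≈0 = inj₁ (λ { zero → a≈0 ; (suc m) → p≈0 m })

-- Polynomials over an algebraically closed field of characteristic zero.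

module AlgebraicallyClosedField {c ℓ} (F : Field c ℓ)
  (char0 : FieldProperties.CharacteristicZero F)
  (closed : ∀ p n → Polynomials.HasDegree (Field.rawRing F) p (suc n) →
    ∃[ x ] Field._≈_ F (Polynomials.eval (Field.rawRing F) p x) (Field.0# F)) where
  open FieldProperties F
  open PolynomialProperties F
  open Reasoning

  -- If p had positive degree, then 1 + p would have a root.
  eval≈0⇒≈0 : ∀ p → (∀ x → eval p x ≈ 0#) → p ≈ₚ []
  eval≈0⇒≈0 p vanishes with zero⊎degree p
  ... | inj₁ p≈0 = p≈0
  ... | inj₂ (zero , p₀≉0 , p>0≈0) = contradiction
    (trans (sym (eval-constant p 0# (λ n → p>0≈0 (suc n) (s≤s z≤n)))) (vanishes 0#)) p₀≉0
  ... | inj₂ (suc n , pₙ≉0 , p>n≈0) = contradiction (begin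
    1#                          ≈⟨ +-identityʳ 1# ⟨
    1# + 0#                     ≈⟨ +-cong (eval-[] 1# x) (vanishes x) ⟨
    eval [ 1# ] x + eval p x    ≈⟨ eval-+ₚ [ 1# ] p x ⟨
    eval ([ 1# ] +ₚ p) x        ≈⟨ proj₂ root ⟩
    0#                          ∎) 1#0
    where
    coeff-1+p : ∀ m → coeff ([ 1# ] +ₚ p) (suc m) ≈ coeff p (suc m)
    coeff-1+p m = trans (coeff-+ₚ [ 1# ] p (suc m)) (+-identityˡ _)
    root = closed ([ 1# ] +ₚ p) n
      ( (λ ≈0 → pₙ≉0 (trans (sym (coeff-1+p n)) ≈0))
      , (λ { (suc m) n<m → trans (coeff-1+p m) (p>n≈0 (suc m) n<m) }))
    x = proj₁ root

  -- Applies `eval≈0⇒≈0` to `p - q`, with subtraction written as scaling by `- 1#`. This is the way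
  -- back from values to coefficients.
  eval-injective : ∀ p q → (∀ x → eval p x ≈ eval q x) → p ≈ₚ q
  eval-injective p q p≗q n = x-y≈0⇒x≈y _ _ (begin
    coeff p n - coeff q n                 ≈⟨ +-congˡ (-1*x≈-x _) ⟨
    coeff p n + - 1# * coeff q n          ≈⟨ +-congˡ (coeff-scale (- 1#) q n) ⟨
    coeff p n + coeff (map (- 1# *_) q) n ≈⟨ coeff-+ₚ p _ n ⟨
    coeff (p +ₚ map (- 1# *_) q) n        ≈⟨ eval≈0⇒≈0 (p +ₚ map (- 1# *_) q) difference n ⟩
    0#                                    ∎)
    where
    difference : ∀ x → eval (p +ₚ map (- 1# *_) q) x ≈ 0#
    difference x = begin
      eval (p +ₚ map (- 1# *_) q) x         ≈⟨ eval-+ₚ p (map (- 1# *_) q) x ⟩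
      eval p x + eval (map (- 1# *_) q) x   ≈⟨ +-cong (p≗q x) (eval-scale (- 1#) q x) ⟩
      eval q x + - 1# * eval q x            ≈⟨ +-congˡ (-1*x≈-x _) ⟩
      eval q x - eval q x                   ≈⟨ -‿inverseʳ _ ⟩
      0#                                    ∎

  nthRoot : ∀ n a → ∃[ x ] x ^ suc n ≈ a
  nthRoot n a = proj₁ root , sym (begin
    a                                     ≈⟨ +-identityʳ a ⟨
    a + 0#                                ≈⟨ +-congˡ (proj₂ root) ⟨
    a + (- a + x * eval (monomial 1# n) x) ≈⟨ +-assoc _ _ _ ⟨
    a - a + x * eval (monomial 1# n) x    ≈⟨ +-cong (-‿inverseʳ a) (*-congˡ (eval-monomial 1# n x)) ⟩
    0# + x * (1# * x ^ n)                 ≈⟨ solve 2 (λ x y →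
      con 0 :+ x :* (con 1 :* y) := x :* y) refl x _ ⟩
    x * x ^ n                             ∎)
    where
    -- The list is `zⁿ⁺¹ - a`: putting `- a` in front shifts `zⁿ` up by one degree.
    root = closed (- a ∷ monomial 1# n) n
      ( (λ 1≈0 → 1#0 (trans (sym (coeff-monomial-top 1# n)) 1≈0))
      , (λ { (suc m) (s≤s n<m) → coeff-monomial-above 1# n m n<m }))
    x = proj₁ root

  -- Induction on the degree. Algebraic closedness supplies a root, necessarily γ; roots of the
  -- quotient by `z - γ` are roots of `p`, so the quotient inherits the hypothesis.
  onlyRoot⇒linearPower : ∀ {γ c} → γ + c ≈ 0# → ∀ n p → HasDegree p n →
    (∀ x → eval p x ≈ 0# → x ≈ γ) → ∃[ a ] p ≈ₚ linearPower a c n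
  onlyRoot⇒linearPower γ+c≈0 zero p (_ , p>0≈0) _ =
    coeff p 0 , λ { zero → refl ; (suc m) → p>0≈0 (suc m) (s≤s z≤n) }
  onlyRoot⇒linearPower {γ} {c} γ+c≈0 (suc n) p deg onlyRoot =
    proj₁ rest , λ m → trans (factor m)
      (⊹-cong c {quotient γ p} {linearPower (proj₁ rest) c n} (proj₂ rest) m)
    where
    root = closed p n deg
    pγ≈0 : eval p γ ≈ 0#
    pγ≈0 = trans (eval-congʳ p (sym (onlyRoot _ (proj₂ root)))) (proj₂ root)
    factor = root⇒factor γ+c≈0 p pγ≈0
    rest = onlyRoot⇒linearPower γ+c≈0 n (quotient γ p) (quotient-degree γ {p} deg)
      (λ x qx≈0 → onlyRoot x (begin
        eval p x                          ≈⟨ eval-cong p (c ⊹ quotient γ p) x factor ⟩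
        eval (c ⊹ quotient γ p) x         ≈⟨ eval-⊹ c (quotient γ p) x ⟩
        (x + c) * eval (quotient γ p) x   ≈⟨ *-congˡ qx≈0 ⟩
        (x + c) * 0#                      ≈⟨ zeroʳ _ ⟩
        0#                                ∎))

  -- Integration: f′ and the derivative of `linearPower a c d` agree, and `suc k` is cancelled from
  -- each coefficient. Fixing `a` as a coefficient of `f`, rather than asserting that some `a`
  -- exists, shows at once that it comes from `K`.
  onlyCriticalPoint⇒linearPower : ∀ {γ c n} f → γ + c ≈ 0# → HasDegree f (suc (suc n)) →
    (∀ x → eval (derivative f) x ≈ 0# → x ≈ γ) →
    let a = coeff f (suc (suc n)) in
    ∃[ b ] f ≈ₚ linearPower a c (suc (suc n)) +ₚ [ b ]
  onlyCriticalPoint⇒linearPower {γ} {c} {n} f γ+c≈0 deg onlyRoot = b , f≈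
    where
    d = suc (suc n)
    a = coeff f d
    p = linearPower a c d
    -- The derivative does not see the constant coefficient; `b` absorbs the difference there.
    b = coeff f 0 - coeff p 0
    f′ = onlyRoot⇒linearPower γ+c≈0 (suc n) (derivative f)
      (derivative-degree char0 {f} deg) onlyRoot
    a′ = proj₁ f′
    a′≈d·a : a′ ≈ d · a
    a′≈d·a = begin
      a′                                      ≈⟨ coeff-linearPower-top a′ c (suc n) ⟨
      coeff (linearPower a′ c (suc n)) (suc n) ≈⟨ proj₂ f′ (suc n) ⟨
      coeff (derivative f) (suc n)            ≈⟨ coeff-derivative f (suc n) ⟩
      d · a                                   ∎
    f≈ : f ≈ₚ p +ₚ [ b ]
    f≈ zero = sym (begin
      coeff (p +ₚ [ b ]) 0                    ≈⟨ coeff-+ₚ p [ b ] 0 ⟩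
      coeff p 0 + (coeff f 0 - coeff p 0)     ≈⟨ +-comm _ _ ⟩
      coeff f 0 - coeff p 0 + coeff p 0       ≈⟨ +-assoc _ _ _ ⟩
      coeff f 0 + (- coeff p 0 + coeff p 0)   ≈⟨ +-congˡ (-‿inverseˡ _) ⟩
      coeff f 0 + 0#                          ≈⟨ +-identityʳ _ ⟩
      coeff f 0                               ∎)
    f≈ (suc k) = trans (·-cancelˡ char0 k (begin
      suc k · coeff f (suc k)                 ≈⟨ coeff-derivative f k ⟨
      coeff (derivative f) k                  ≈⟨ proj₂ f′ k ⟩
      coeff (linearPower a′ c (suc n)) k      ≈⟨ linearPower-cong c (suc n) a′≈d·a k ⟩
      coeff (linearPower (d · a) c (suc n)) k ≈⟨ coeff-linearPower-· d a c (suc n) k ⟩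
      d · coeff (linearPower a c (suc n)) k   ≈⟨ coeff-linearPower-suc a c (suc n) k ⟨
      suc k · coeff p (suc k)                 ∎))
      (sym (trans (coeff-+ₚ p [ b ] (suc k)) (+-identityʳ _)))

  -- Affine conjugacy tested on values.

  eval-affine : ∀ α β x → eval (affine F α β) x ≈ α * x + β
  eval-affine α β x =
    solve 3 (λ α β x → β :+ x :* (α :+ x :* con 0) := α :* x :+ β) refl α β x

  module _ {α : Carrier} (β : Carrier) (α≉0 : α ≉ 0#) where
    private α⁻¹ = inverse α α≉0

    affine⁻¹-affine : ∀ y → eval (affine⁻¹ F α β α≉0) (α * y + β) ≈ y
    affine⁻¹-affine y = begin
      eval (affine⁻¹ F α β α≉0) (α * y + β)  ≈⟨ eval-affine α⁻¹ _ _ ⟩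
      α⁻¹ * (α * y + β) - α⁻¹ * β            ≈⟨ +-congʳ (solve 4 (λ α⁻¹ α y β →
        α⁻¹ :* (α :* y :+ β) := α⁻¹ :* α :* y :+ α⁻¹ :* β) refl α⁻¹ α y β) ⟩
      α⁻¹ * α * y + α⁻¹ * β - α⁻¹ * β        ≈⟨ +-assoc _ _ _ ⟩
      α⁻¹ * α * y + (α⁻¹ * β - α⁻¹ * β)      ≈⟨ +-cong (*-congʳ (inverseˡ α≉0)) (-‿inverseʳ _) ⟩
      1# * y + 0#                            ≈⟨ solve 1 (λ y → con 1 :* y :+ con 0 := y) refl y ⟩
      y                                      ∎

    affine-affine⁻¹ : ∀ x → α * eval (affine⁻¹ F α β α≉0) x + β ≈ x
    affine-affine⁻¹ x = begin
      α * eval (affine⁻¹ F α β α≉0) x + β    ≈⟨ +-congʳ (*-congˡ (eval-affine α⁻¹ _ x)) ⟩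
      α * (α⁻¹ * x - α⁻¹ * β) + β            ≈⟨ +-cong (distribˡ α _ _) (sym β≈) ⟩
      α * (α⁻¹ * x) + α * - (α⁻¹ * β) + α * (α⁻¹ * β) ≈⟨ +-assoc _ _ _ ⟩
      α * (α⁻¹ * x) + (α * - (α⁻¹ * β) + α * (α⁻¹ * β)) ≈⟨ +-congˡ (distribˡ α _ _) ⟨
      α * (α⁻¹ * x) + α * (- (α⁻¹ * β) + α⁻¹ * β) ≈⟨ +-congˡ (*-congˡ (-‿inverseˡ _)) ⟩
      α * (α⁻¹ * x) + α * 0#                 ≈⟨ solve 3 (λ α α⁻¹ x →
        α :* (α⁻¹ :* x) :+ α :* con 0 := α :* α⁻¹ :* x) refl α α⁻¹ x ⟩
      α * α⁻¹ * x                            ≈⟨ *-congʳ (inverseʳ α≉0) ⟩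
      1# * x                                 ≈⟨ *-identityˡ x ⟩
      x                                      ∎
      where
      β≈ : α * (α⁻¹ * β) ≈ β
      β≈ = trans (sym (*-assoc _ _ _)) (trans (*-congʳ (inverseʳ α≉0)) (*-identityˡ β))

    private
      conjugated : Polynomial → Polynomial
      conjugated f = affine F α β ∘ₚ f ∘ₚ affine⁻¹ F α β α≉0

      eval-conjugated : ∀ f x →
        eval (conjugated f) x ≈ α * eval f (eval (affine⁻¹ F α β α≉0) x) + β
      eval-conjugated f x = begin
        eval (conjugated f) x
          ≈⟨ eval-∘ₚ (affine F α β) (f ∘ₚ affine⁻¹ F α β α≉0) x ⟩
        eval (affine F α β) (eval (f ∘ₚ affine⁻¹ F α β α≉0) x)
          ≈⟨ eval-affine α β _ ⟩
        α * eval (f ∘ₚ affine⁻¹ F α β α≉0) x + β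
          ≈⟨ +-congʳ (*-congˡ (eval-∘ₚ f (affine⁻¹ F α β α≉0) x)) ⟩
        α * eval f (eval (affine⁻¹ F α β α≉0) x) + β ∎

    conjugate⇒semiconjugate : ∀ {f g} → g ≈ₚ affine F α β ∘ₚ f ∘ₚ affine⁻¹ F α β α≉0 →
      ∀ y → eval g (α * y + β) ≈ α * eval f y + β
    conjugate⇒semiconjugate {f} {g} g≈ y = begin
      eval g (α * y + β)
        ≈⟨ eval-cong g (conjugated f) _ g≈ ⟩
      eval (conjugated f) (α * y + β)
        ≈⟨ eval-conjugated f _ ⟩
      α * eval f (eval (affine⁻¹ F α β α≉0) (α * y + β)) + β
        ≈⟨ +-congʳ (*-congˡ (eval-congʳ f (affine⁻¹-affine y))) ⟩
      α * eval f y + β ∎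

    -- Every `x` has the form `α * y + β`, so the two sides agree at all points, and
    -- `eval-injective` makes this an equality of polynomials.
    semiconjugate⇒conjugate : ∀ {f g} → (∀ y → eval g (α * y + β) ≈ α * eval f y + β) →
      ConjugateOver F f g
    semiconjugate⇒conjugate {f} {g} semiconj =
      α , β , α≉0 , eval-injective g (conjugated f) (λ x → begin
        eval g x
          ≈⟨ eval-congʳ g (affine-affine⁻¹ x) ⟨
        eval g (α * eval (affine⁻¹ F α β α≉0) x + β)
          ≈⟨ semiconj _ ⟩
        α * eval f (eval (affine⁻¹ F α β α≉0) x) + β
          ≈⟨ eval-conjugated f x ⟨
        eval (conjugated f) x ∎)

  -- Degree `d` gives `a` and degree `d - 1` gives `d a c`. As `d ≥ 2`, both degrees are positive
  -- and the additive constants do not interfere; these are compared last, at `x = 0`.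
  linearPower+constant-injective : ∀ {a c b a′ c′ b′} n → a ≉ 0# →
    (∀ x → a * (x + c) ^ suc (suc n) + b ≈ a′ * (x + c′) ^ suc (suc n) + b′) →
    a ≈ a′ × c ≈ c′ × b ≈ b′
  linearPower+constant-injective {a} {c} {b} {a′} {c′} {b′} n a≉0 f≗g = a≈a′ , c≈c′ , b≈b′
    where
    d = suc (suc n)
    p = linearPower a c d
    q = linearPower a′ c′ d
    eval-+constant : ∀ a c b x →
      eval (linearPower a c d +ₚ [ b ]) x ≈ a * (x + c) ^ d + b
    eval-+constant a c b x = trans (eval-+ₚ (linearPower a c d) [ b ] x)
      (+-cong (eval-linearPower a c d x) (eval-[] b x))
    coeff-+constant : ∀ a c b m →
      coeff (linearPower a c d +ₚ [ b ]) (suc m) ≈ coeff (linearPower a c d) (suc m)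
    coeff-+constant a c b m =
      trans (coeff-+ₚ (linearPower a c d) [ b ] (suc m)) (+-identityʳ _)
    coeffs : ∀ m → coeff p (suc m) ≈ coeff q (suc m)
    coeffs m = begin
      coeff p (suc m)               ≈⟨ coeff-+constant a c b m ⟨
      coeff (p +ₚ [ b ]) (suc m)    ≈⟨ eval-injective (p +ₚ [ b ]) (q +ₚ [ b′ ]) (λ x →
        trans (eval-+constant a c b x)
              (trans (f≗g x) (sym (eval-+constant a′ c′ b′ x)))) (suc m) ⟩
      coeff (q +ₚ [ b′ ]) (suc m)   ≈⟨ coeff-+constant a′ c′ b′ m ⟩
      coeff q (suc m)               ∎
    a≈a′ : a ≈ a′
    a≈a′ = trans (sym (coeff-linearPower-top a c d))
      (trans (coeffs (suc n)) (coeff-linearPower-top a′ c′ d))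
    c≈c′ : c ≈ c′
    c≈c′ = *-cancelˡ-nonZero a≉0 (trans (·-cancelˡ char0 (suc n)
      (trans (sym (coeff-linearPower-subtop a c (suc n)))
        (trans (coeffs n) (coeff-linearPower-subtop a′ c′ (suc n)))))
      (*-congʳ (sym a≈a′)))
    b≈b′ : b ≈ b′
    b≈b′ = +-cancelˡ _ b b′ (trans (f≗g 0#)
      (+-congʳ (*-cong (sym a≈a′) (^-congˡ d (+-congˡ (sym c≈c′))))))

  -- The two normal forms over the closure.

  module NormalForms {f : Polynomial} {a c b : Carrier} {n : ℕ} (a≉0 : a ≉ 0#)
    (eval-f : ∀ y → eval f y ≈ a * (y + c) ^ suc (suc n) + b) where
    private
      d = suc (suc n)

      factor : ∀ α y → (α * y + α * c) ^ d ≈ α ^ d * (y + c) ^ d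
      factor α y = trans (^-congˡ d (sym (distribˡ α y c))) (^-distrib-* α (y + c) d)

    conjugate-to-power : ∀ {g} → (∀ x → eval g x ≈ x ^ d) → b + c ≈ 0# → ConjugateOver F f g
    conjugate-to-power {g} eval-g b+c≈0 = semiconjugate⇒conjugate (α * c) α≉0 {f} {g} (λ y → begin
      eval g (α * y + α * c)                    ≈⟨ eval-g _ ⟩
      (α * y + α * c) ^ d                       ≈⟨ factor α y ⟩
      α * α ^ suc n * (y + c) ^ d               ≈⟨ *-congʳ (*-congˡ αⁿ≈a) ⟩
      α * a * (y + c) ^ d                       ≈⟨ solve 3 (λ α a z →
        α :* a :* z := α :* (a :* z) :+ α :* con 0) refl α a _ ⟩
      -- The zero is inserted to be replaced by `b + c`, which supplies the constant terms of
      -- `α f(y) + α c`.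
      α * (a * (y + c) ^ d) + α * 0#            ≈⟨ +-congˡ (*-congˡ b+c≈0) ⟨
      α * (a * (y + c) ^ d) + α * (b + c)       ≈⟨ solve 4 (λ α z b c →
        α :* z :+ α :* (b :+ c) := α :* (z :+ b) :+ α :* c) refl α _ b c ⟩
      α * (a * (y + c) ^ d + b) + α * c         ≈⟨ +-congʳ (*-congˡ (eval-f y)) ⟨
      α * eval f y + α * c                      ∎)
      where
      α = proj₁ (nthRoot n a)
      αⁿ≈a = proj₂ (nthRoot n a)
      -- The exponent `suc n` is `d - 1 ≥ 1`, so `α` is a factor of the nonzero `a`.
      α≉0 : α ≉ 0#
      α≉0 α≈0 = a≉0 (trans (sym αⁿ≈a) (trans (*-congʳ α≈0) (zeroˡ _)))

    -- With `e = b + c` and `α = 1 / e`, the factor `e ^ suc n` cancels all but one of the `d`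
    -- factors `α`, leaving the leading coefficient `α * a` of `α f`. The constant `1#` is `α * e`.
    conjugate-to-power+1 : ∀ {g} → (∀ x → eval g x ≈ (a * (b + c) ^ suc n) * x ^ d + 1#) →
      b + c ≉ 0# → ConjugateOver F f g
    conjugate-to-power+1 {g} eval-g b+c≉0 =
      semiconjugate⇒conjugate (α * c) α≉0 {f} {g} (λ y → begin
      eval g (α * y + α * c)
        ≈⟨ eval-g _ ⟩
      (a * e ^ suc n) * (α * y + α * c) ^ d + 1#
        ≈⟨ +-cong (*-congˡ (factor α y)) (sym αe≈1) ⟩
      (a * e ^ suc n) * (α * α ^ suc n * (y + c) ^ d) + α * e
        ≈⟨ +-congʳ (solve 5 (λ a u α v z →
             (a :* u) :* (α :* v :* z) := (v :* u) :* (α :* (a :* z))) refl a _ α _ _) ⟩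
      (α ^ suc n * e ^ suc n) * (α * (a * (y + c) ^ d)) + α * e
        ≈⟨ +-congʳ (*-congʳ (^-distrib-* α e (suc n))) ⟨
      (α * e) ^ suc n * (α * (a * (y + c) ^ d)) + α * e
        ≈⟨ +-congʳ (*-congʳ (trans (^-congˡ (suc n) αe≈1) (1^n≈1 (suc n)))) ⟩
      1# * (α * (a * (y + c) ^ d)) + α * (b + c)
        ≈⟨ solve 4 (λ α z b c →
             con 1 :* (α :* z) :+ α :* (b :+ c) := α :* (z :+ b) :+ α :* c) refl α _ b c ⟩
      α * (a * (y + c) ^ d + b) + α * c
        ≈⟨ +-congʳ (*-congˡ (eval-f y)) ⟨
      α * eval f y + α * c ∎)
      where
      e = b + c
      α = inverse e b+c≉0
      αe≈1 = inverseˡ b+c≉0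
      α≉0 = invertible⇒nonZero αe≈1

    -- The semiconjugacy equates two functions of the shape `a (y + c)ᵈ + b`, so their parameters
    -- agree. The shifts give `α * c ≈ β`, the constants give `α * b + β ≈ 1#`, hence
    -- `α * (b + c) ≈ 1#`; this eliminates `α` from `α * a ≈ A * α ^ d`.
    conjugate-to-power+1⇒ : ∀ {g A} → (∀ x → eval g x ≈ A * x ^ d + 1#) →
      ConjugateOver F f g → A ≈ a * (b + c) ^ suc n
    conjugate-to-power+1⇒ {g} {A} eval-g (α , β , α≉0 , g≈) = begin
      A                                       ≈⟨ *-identityʳ A ⟨
      -- The factor `(α * e) ^ d` brings in the `α ^ d` needed to use the equality of leading
      -- coefficients.
      A * 1#                                  ≈⟨ *-congˡ (trans (^-congˡ d αe≈1) (1^n≈1 d)) ⟨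
      A * (α * e) ^ d                         ≈⟨ *-congˡ (^-distrib-* α e d) ⟩
      A * (α ^ d * e ^ d)                     ≈⟨ *-assoc _ _ _ ⟨
      A * α ^ d * e ^ d                       ≈⟨ *-congʳ (proj₁ coefficients) ⟨
      α * a * (e * e ^ suc n)                 ≈⟨ solve 4 (λ α a e z →
        α :* a :* (e :* z) := (α :* e) :* (a :* z)) refl α a e _ ⟩
      (α * e) * (a * e ^ suc n)               ≈⟨ *-congʳ αe≈1 ⟩
      1# * (a * e ^ suc n)                    ≈⟨ *-identityˡ _ ⟩
      a * e ^ suc n                           ∎
      where
      e = b + c
      -- Chosen so that `α * y + β` is `α * (y + η)`; then `- η` is the point sent to 0.
      η = inverse α α≉0 * β
      αη≈β : α * η ≈ β
      αη≈β = trans (sym (*-assoc _ _ _)) (trans (*-congʳ (inverseʳ α≉0)) (*-identityˡ β))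
      identity : ∀ y → α * a * (y + c) ^ d + (α * b + β) ≈ A * α ^ d * (y + η) ^ d + 1#
      identity y = begin
        α * a * (y + c) ^ d + (α * b + β)      ≈⟨ solve 5 (λ α a z b β →
          α :* a :* z :+ (α :* b :+ β) := α :* (a :* z :+ b) :+ β) refl α a _ b β ⟩
        α * (a * (y + c) ^ d + b) + β          ≈⟨ +-congʳ (*-congˡ (eval-f y)) ⟨
        α * eval f y + β                       ≈⟨ conjugate⇒semiconjugate β α≉0 {f} {g} g≈ y ⟨
        eval g (α * y + β)                     ≈⟨ eval-g _ ⟩
        A * (α * y + β) ^ d + 1#               ≈⟨ +-congʳ (*-congˡ (^-congˡ d (+-congˡ αη≈β))) ⟨
        A * (α * y + α * η) ^ d + 1#           ≈⟨ +-congʳ (*-congˡ (^-congˡ d (distribˡ α y η))) ⟨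
        A * (α * (y + η)) ^ d + 1#             ≈⟨ +-congʳ (*-congˡ (^-distrib-* α (y + η) d)) ⟩
        A * (α ^ d * (y + η) ^ d) + 1#         ≈⟨ +-congʳ (*-assoc _ _ _) ⟨
        A * α ^ d * (y + η) ^ d + 1#           ∎
      coefficients = linearPower+constant-injective n (*-nonZero α≉0 a≉0) identity
      αe≈1 : α * e ≈ 1#
      αe≈1 = begin
        α * (b + c)    ≈⟨ distribˡ α b c ⟩
        α * b + α * c  ≈⟨ +-congˡ (*-congˡ (proj₁ (proj₂ coefficients))) ⟩
        α * b + α * η  ≈⟨ +-congˡ αη≈β ⟩
        α * b + β      ≈⟨ proj₂ (proj₂ coefficients) ⟩
        1#             ∎

-- Descent of the parameters from the closure to `K`.

module UnicriticalPolynomials {k ℓ k′ ℓ′} (K : Field k ℓ) (isNumberField : IsNumberField K)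
  (K̄ : AlgebraicClosure K k′ ℓ′) where
  open AlgebraicClosure K̄ using (closure; ι; algebraicallyClosed)
  private
    module K where
      open FieldProperties K public
      open PolynomialProperties K public
  open FieldProperties closure
  open PolynomialProperties closure
  open FieldHomomorphism K closure ι (AlgebraicClosure.isRingHomomorphism K̄)
  open Reasoning

  K-characteristicZero : K.CharacteristicZero
  K-characteristicZero = FieldHomomorphism.characteristicZero ℚ-field K
    (IsNumberField.fromℚ isNumberField) (IsNumberField.isRingHomomorphism isNumberField)
    ℚ-characteristicZero

  open AlgebraicallyClosedField closure
    (characteristicZero K-characteristicZero) algebraicallyClosed

  map-degree : ∀ f n → K.HasDegree f n → HasDegree (map ι f) n
  map-degree f n (fₙ≉0 , f>n≈0) =
    (λ ≈0 → nonZero-homo fₙ≉0 (trans (sym (coeff-map f n)) ≈0)) ,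
    (λ m n<m → trans (coeff-map f m) (trans (⟦⟧-cong (f>n≈0 m n<m)) 0#-homo))

  coeff-map-+ₚ : ∀ p q → map ι (p K.+ₚ q) ≈ₚ map ι p +ₚ map ι q
  coeff-map-+ₚ p q n = begin
    coeff (map ι (p K.+ₚ q)) n             ≈⟨ coeff-map (p K.+ₚ q) n ⟩
    ι (K.coeff (p K.+ₚ q) n)               ≈⟨ ⟦⟧-cong (K.coeff-+ₚ p q n) ⟩
    ι (K.coeff p n K.+ K.coeff q n)        ≈⟨ +-homo _ _ ⟩
    ι (K.coeff p n) + ι (K.coeff q n)      ≈⟨ +-cong (coeff-map p n) (coeff-map q n) ⟨
    coeff (map ι p) n + coeff (map ι q) n  ≈⟨ coeff-+ₚ (map ι p) (map ι q) n ⟨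
    coeff (map ι p +ₚ map ι q) n           ∎

  eval-map-monomial : ∀ a n x → eval (map ι (K.monomial a n)) x ≈ ι a * x ^ n
  eval-map-monomial a zero    x = trans (eval-[] (ι a) x) (sym (*-identityʳ _))
  eval-map-monomial a (suc n) x = begin
    ι K.0# + x * eval (map ι (K.monomial a n)) x
      ≈⟨ +-cong 0#-homo (*-congˡ (eval-map-monomial a n x)) ⟩
    0# + x * (ι a * x ^ n)
      ≈⟨ solve 3 (λ a x y → con 0 :+ x :* (a :* y) := a :* (x :* y)) refl _ x _ ⟩
    ι a * (x * x ^ n) ∎

  eval-map-monomial+1 : ∀ a n x →
    eval (map ι (K.monomial a n K.+ₚ [ K.1# ])) x ≈ ι a * x ^ n + 1#
  eval-map-monomial+1 a n x = begin
    eval (map ι (K.monomial a n K.+ₚ [ K.1# ])) x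
      ≈⟨ eval-cong (map ι (K.monomial a n K.+ₚ [ K.1# ])) (map ι (K.monomial a n) +ₚ [ ι K.1# ])
           x (coeff-map-+ₚ (K.monomial a n) [ K.1# ]) ⟩
    eval (map ι (K.monomial a n) +ₚ [ ι K.1# ]) x
      ≈⟨ eval-+ₚ (map ι (K.monomial a n)) [ ι K.1# ] x ⟩
    eval (map ι (K.monomial a n)) x + eval [ ι K.1# ] x
      ≈⟨ +-cong (eval-map-monomial a n x) (trans (eval-[] _ x) 1#-homo) ⟩
    ι a * x ^ n + 1# ∎

  -- c lies in K because the two top coefficients of f are a and d a c, and then so
  -- does b = f(- c).
  unicritical⇒linearPower : ∀ {n} f → K.HasDegree f (suc (suc n)) → Unicritical K̄ f →
    ∃[ a ] ∃[ c ] ∃[ b ] (a K.≉ K.0# ×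
      (∀ y → eval (map ι f) y ≈ ι a * (y + ι c) ^ suc (suc n) + ι b))
  unicritical⇒linearPower {n} f deg (γ , _ , γ-unique) =
    a , c , b , proj₁ deg , λ y → trans (eval-f̄ y)
      (+-cong (*-cong ā≈ιa (^-congˡ d (+-congˡ (sym ιc≈c̄)))) (sym ιb≈b̄))
    where
    d = suc (suc n)
    f̄ = map ι f
    ā = coeff f̄ d
    c̄ = - γ
    normalForm = onlyCriticalPoint⇒linearPower f̄ (-‿inverseʳ γ) (map-degree f d deg)
      (λ x f′x≈0 → sym (γ-unique f′x≈0))
    b̄ = proj₁ normalForm

    eval-f̄ : ∀ y → eval f̄ y ≈ ā * (y + c̄) ^ d + b̄
    eval-f̄ y = begin
      eval f̄ y
        ≈⟨ eval-cong f̄ (linearPower ā c̄ d +ₚ [ b̄ ]) y (proj₂ normalForm) ⟩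
      eval (linearPower ā c̄ d +ₚ [ b̄ ]) y
        ≈⟨ eval-+ₚ (linearPower ā c̄ d) [ b̄ ] y ⟩
      eval (linearPower ā c̄ d) y + eval [ b̄ ] y
        ≈⟨ +-cong (eval-linearPower ā c̄ d y) (eval-[] b̄ y) ⟩
      ā * (y + c̄) ^ d + b̄ ∎

    a = K.coeff f d
    ā≈ιa : ā ≈ ι a
    ā≈ιa = coeff-map f d

    d·a≉0 : d K.· a K.≉ K.0#
    d·a≉0 d·a≈0 = proj₁ deg (K.·-cancelˡ K-characteristicZero (suc n)
      (K.trans d·a≈0 (K.sym (K.·-zeroʳ d))))

    c = K.inverse (d K.· a) d·a≉0 K.* K.coeff f (suc n)
    ιc≈c̄ : ι c ≈ c̄
    ιc≈c̄ = *-cancelˡ-nonZero (nonZero-homo d·a≉0) (begin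
      ι (d K.· a) * ι c
        ≈⟨ *-homo _ _ ⟨
      ι (d K.· a K.* c)
        ≈⟨ ⟦⟧-cong (K.trans (K.sym (K.*-assoc _ _ _))
             (K.trans (K.*-congʳ (K.inverseʳ d·a≉0)) (K.*-identityˡ _))) ⟩
      ι (K.coeff f (suc n))
        ≈⟨ coeff-map f (suc n) ⟨
      coeff f̄ (suc n)
        ≈⟨ proj₂ normalForm (suc n) ⟩
      coeff (linearPower ā c̄ d +ₚ [ b̄ ]) (suc n)
        ≈⟨ coeff-+ₚ (linearPower ā c̄ d) [ b̄ ] (suc n) ⟩
      -- The index `suc n` is `d - 1 ≥ 1`, so `b̄` contributes nothing.
      coeff (linearPower ā c̄ d) (suc n) + 0#
        ≈⟨ +-identityʳ _ ⟩
      coeff (linearPower ā c̄ d) (suc n)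
        ≈⟨ coeff-linearPower-subtop ā c̄ (suc n) ⟩
      d · (ā * c̄)
        ≈⟨ ×-assoc-* d ā c̄ ⟨
      (d · ā) * c̄
        ≈⟨ *-congʳ (trans (·-homo d a) (×-congʳ d (sym ā≈ιa))) ⟨
      ι (d K.· a) * c̄ ∎)

    b = K.eval f (K.- c)
    ιb≈b̄ : ι b ≈ b̄
    ιb≈b̄ = begin
      ι b
        ≈⟨ eval-map f (K.- c) ⟨
      eval f̄ (ι (K.- c))
        ≈⟨ eval-f̄ _ ⟩
      ā * (ι (K.- c) + c̄) ^ d + b̄
        ≈⟨ +-congʳ (*-congˡ (*-congʳ (trans (+-cong (-‿homo c) (sym ιc≈c̄)) (-‿inverseˡ _)))) ⟩
      ā * (0# * (ι (K.- c) + c̄) ^ suc n) + b̄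
        ≈⟨ solve 3 (λ a z b → a :* (con 0 :* z) :+ b := b) refl ā _ b̄ ⟩
      b̄ ∎

  -- Existence and uniqueness of the normal form over `K`.

  module Classification {f : K.Polynomial} {a c b : K.Carrier} {n : ℕ} (a≉0 : a K.≉ K.0#)
    (eval-f : ∀ y → eval (map ι f) y ≈ ι a * (y + ι c) ^ suc (suc n) + ι b) where
    private d = suc (suc n)
    open NormalForms {map ι f} {ι a} {ι c} {ι b} {n} (nonZero-homo a≉0) eval-f

    power+1 : K.Carrier → K.Polynomial
    power+1 A = K.monomial A d K.+ₚ [ K.1# ]

    -- Formed in `K`, so that the normal form has coefficients there; `ιA≈` matches its image with
    -- the constant found over the closure.
    A : K.Carrier
    A = a K.* (b K.+ c) K.^ suc n

    ιA≈ : ι A ≈ ι a * (ι b + ι c) ^ suc n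
    ιA≈ = trans (*-homo _ _)
      (*-congˡ (trans (^-homo (b K.+ c) (suc n)) (^-congˡ (suc n) (+-homo b c))))

    conjugate-power : b K.+ c K.≈ K.0# → Conjugate K̄ f (K.monomial K.1# d)
    conjugate-power b+c≈0 = conjugate-to-power {map ι (K.monomial K.1# d)}
      (λ x → trans (eval-map-monomial K.1# d x) (trans (*-congʳ 1#-homo) (*-identityˡ _)))
      (trans (sym (+-homo b c)) (trans (⟦⟧-cong b+c≈0) 0#-homo))

    conjugate-power+1 : b K.+ c K.≉ K.0# → Conjugate K̄ f (power+1 A)
    conjugate-power+1 b+c≉0 = conjugate-to-power+1 {map ι (power+1 A)}
      (λ x → trans (eval-map-monomial+1 A d x) (+-congʳ (*-congʳ ιA≈)))
      (λ ιb+ιc≈0 → nonZero-homo b+c≉0 (trans (+-homo b c) ιb+ιc≈0))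

    -- The closure determines `ι A′`, and injectivity of `ι` turns this into `A ≈ A′`. The
    -- polynomial `g` is only equal to `power+1 A′` up to trailing zeros, hence the hypothesis
    -- `g ≈ₚ power+1 A′`.
    power+1-unique : ∀ {g A′} → g K.≈ₚ power+1 A′ → Conjugate K̄ f g → power+1 A K.≈ₚ g
    power+1-unique {g} {A′} g≈ conjugate m = K.trans
      (K.+ₚ-congʳ {K.monomial A d} {K.monomial A′ d} [ K.1# ] (K.monomial-cong d A≈A′) m)
      (K.sym (g≈ m))
      where
      eval-g : ∀ x → eval (map ι g) x ≈ ι A′ * x ^ d + 1#
      eval-g x = trans
        (eval-cong (map ι g) (map ι (power+1 A′)) x (map-cong-≈ₚ {g} {power+1 A′} g≈))
        (eval-map-monomial+1 A′ d x)
      A≈A′ : A K.≈ A′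
      A≈A′ = injective (trans ιA≈ (sym (conjugate-to-power+1⇒ {map ι g} eval-g conjugate)))

    classification : Conjugate K̄ f (K.monomial K.1# d)
      ⊎ ∃! K._≈ₚ_ (λ g → (∃[ a ] a K.≉ K.0# × g K.≈ₚ power+1 a) × Conjugate K̄ f g)
    -- Tests whether the critical point is fixed, by the decidable equality of `K`.
    classification with b K.+ c K.≟ K.0#
    ... | yes b+c≈0 = inj₁ (conjugate-power b+c≈0)
    ... | no  b+c≉0 = inj₂
      ( power+1 A
      , ( (A , K.*-nonZero a≉0 (K.^-nonZero (suc n) b+c≉0) , λ _ → K.refl)
        , conjugate-power+1 b+c≉0 )
      , λ { {g} ((A′ , _ , g≈) , conjugate) → power+1-unique {g} {A′} g≈ conjugate } )

theorem2p1 :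
    ∀ {c ℓ c′ ℓ′} (K : Field c ℓ) → IsNumberField K →
    (K̄ : AlgebraicClosure K c′ ℓ′) →
    let open Field K
        open Polynomials rawRing in
    (d : ℕ) → 2 ≤ d →
    (f : Polynomial) → HasDegree f d → Unicritical K̄ f →
    Conjugate K̄ f (monomial 1# d)
    ⊎ ∃! _≈ₚ_ (λ g →
        (∃[ a ] a ≉ 0# × g ≈ₚ monomial a d +ₚ [ 1# ])
        × Conjugate K̄ f g)
theorem2p1 K isNumberField K̄ (suc (suc n)) (s≤s (s≤s z≤n)) f deg unicritical =
  let a , c , b , a≉0 , eval-f = unicritical⇒linearPower f deg unicritical
  in  Classification.classification {f} {a} {c} {b} {n} a≉0 eval-f
  where open UnicriticalPolynomials K isNumberField K̄
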